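{- Let $\mathcal{H}$ be a family of graphs. There are two constants $c_1=c_1(\mathcal{H})$, $c_2=c_2(\mathcal{H})$ such that $$\#\{v\in V(G):\operatorname{adh}(v)\ge c_1\}<c_2$$ for every $\mathcal{H}$-free graph $G$ if and only if $$\mathcal{H}\le\{nK_{1,n},\ K_n^n\}$$ for some positive integer $n$.
   Context: All graphs are finite, undirected and simple. For graphs $H_1,H_2$, write $H_1\le H_2$ if $H_1$ is (isomorphic to) an induced subgraph of $H_2$. A graph $G$ is $\mathcal{H}$-free if there is no $H\in\mathcal{H}$ with $H\le G$. For families of graphs $\mathcal{H}_1,\mathcal{H}_2$, write $\mathcal{H}_1\le\mathcal{H}_2$ if for every $H_2\in\mathcal{H}_2$ there is $H_1\in\mathcal{H}_1$ with $H_1\le H_2$. For a graph $G$, $c(G)$ is its number of connected components. The adhesion of a vertex $v$ of $G$ is $\operatorname{adh}(v)=c(G-v)-c(G)+1$. $K_{1,n}$ is the star with $n$ leaves, $nG$ is the disjoint union of $n$ copies of $G$, and $K_n^n$ is obtained from the complete graph $K_n$ on $n$ vertices by attaching $n$ pendant vertices to every vertex of $K_n$. -}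

module Defs where

open import Data.Bool.Base using (Bool; true; false; _∧_; not; T)
open import Data.Bool.Properties using (T?)
open import Data.Fin.Base using (Fin; zero; suc; punchIn; remQuot)
open import Data.Fin.Properties using (_≟_; any?; suc-injective)
open import Data.Integer.Base as ℤ using (ℤ; +_; 1ℤ)
import Data.Integer.Properties as ℤ
open import Data.List.Base using (List; []; _∷_; length; filter; allFin)
open import Data.List.Membership.Propositional using () renaming (_∈_ to _∈ˡ_)
open import Data.List.Membership.Propositional.Properties using (∈-allFin)
open import Data.List.Relation.Unary.Any using (here; there)
open import Data.Nat.Base using (ℕ; zero; suc; pred; _*_)
open import Data.Product.Base using (∃; _×_; _,_)
open import Data.Sum.Base using (_⊎_; inj₁; inj₂)
open import Function.Base using (_∘_; _on_)
open import Function.Bundles using (_⇔_; mk⇔; Equivalence)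
open import Function.Definitions using (Injective; Surjective)
open import Level using (Level; 0ℓ; _⊔_)
open import Relation.Binary.Construct.Closure.ReflexiveTransitive using (Star; ε; _◅_; _◅◅_; reverse)
open import Relation.Binary.Core using (Rel)
open import Relation.Binary.Definitions using (Decidable)
open import Relation.Binary.PropositionalEquality using (_≡_; refl; sym; cong; cong₂; subst)
open import Relation.Binary.Structures using (IsEquivalence)
open import Relation.Nullary using (¬_; does; yes; no; contradiction)
open import Relation.Nullary.Decidable using (dec-true; does-⇔; map′; _×-dec_; _⊎-dec_)
open import Relation.Unary using (Pred; _∈_)

private
  variable
    ℓ ℓ₁ ℓ₂ : Level

-- Every finite graph is isomorphic to one with vertex set Fin n.

record Graph : Set where
  field
    order      : ℕ
    adj        : Fin order → Fin order → Bool
    adj-sym    : ∀ u v → adj u v ≡ adj v u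
    adj-irrefl : ∀ u → adj u u ≡ false

  V : Set
  V = Fin order

  _~_ : Rel V 0ℓ
  u ~ v = T (adj u v)

open Graph public using (order; V)

-- An injection preserving and reflecting adjacency, i.e. an isomorphism
-- from H₁ onto the subgraph of H₂ induced by the image.

infix 4 _⊑_ _⊑ᶠ_

_⊑_ : Graph → Graph → Set
H₁ ⊑ H₂ = ∃ λ (f : V H₁ → V H₂) →
  Injective _≡_ _≡_ f × (∀ u v → Graph.adj H₁ u v ≡ Graph.adj H₂ (f u) (f v))

-- A family of graphs is a predicate Pred Graph ℓ.

_-Free : Pred Graph ℓ → Pred Graph ℓ
(ℋ -Free) G = ¬ ∃ λ H → H ∈ ℋ × H ⊑ G

-- As ℋ₁ is arbitrary, a proof that H₂ is not ℋ₁-free does not produce the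
-- H₁ required here.  Results passing from -Free to ⊑ᶠ therefore assume
-- ExcludedMiddle explicitly: for ℋ₁ = λ _ → P with ¬ ¬ P, no graph is
-- ℋ₁-free, yet H₁ ∈ ℋ₁ is a proof of P.

_⊑ᶠ_ : Pred Graph ℓ₁ → Pred Graph ℓ₂ → Set (ℓ₁ ⊔ ℓ₂)
ℋ₁ ⊑ᶠ ℋ₂ = ∀ H₂ → H₂ ∈ ℋ₂ → ∃ λ H₁ → H₁ ∈ ℋ₁ × H₁ ⊑ H₂

-- The increasing enumeration of the elements other than v.

others : ∀ {n} → Fin n → Fin (pred n) → Fin n
others {suc n} = punchIn

infixl 6 _∖_

_∖_ : (G : Graph) → V G → Graph
G ∖ v = record
  { order      = pred (order G)
  ; adj        = λ x y → adj (others v x) (others v y)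
  ; adj-sym    = λ x y → adj-sym (others v x) (others v y)
  ; adj-irrefl = λ x → adj-irrefl (others v x)
  }
  where open Graph G using (adj; adj-sym; adj-irrefl)

Connected : (G : Graph) → Rel (V G) 0ℓ
Connected G = Star (Graph._~_ G)

-- The number of classes of an equivalence relation, together with the
-- quotient map that certifies it.

record Quotient {n : ℕ} (R : Rel (Fin n) 0ℓ) : Set where
  field
    size             : ℕ
    class            : Fin n → Fin size
    class-surjective : Surjective _≡_ _≡_ class
    class-≡          : ∀ u v → class u ≡ class v ⇔ R u v

private
  quotient : ∀ {n} {R : Rel (Fin n) 0ℓ} → IsEquivalence R → Decidable R → Quotient R
  quotient {zero} _ _ = record
    { size = 0 ; class = λ () ; class-surjective = λ () ; class-≡ = λ () }
  quotient {suc n} {R} isEq R? = extend (any? (λ v → R? zero (suc v)))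
    where
    module R = IsEquivalence isEq
    rest : Quotient (R on suc)
    rest = quotient
      (record { refl = R.refl ; sym = R.sym ; trans = R.trans })
      (λ u v → R? (suc u) (suc v))
    open Quotient rest
    to : ∀ {u v} → class u ≡ class v → R (suc u) (suc v)
    to = Equivalence.to (class-≡ _ _)
    from : ∀ {u v} → R (suc u) (suc v) → class u ≡ class v
    from = Equivalence.from (class-≡ _ _)

    extend : _ → Quotient R
    extend (yes (w , 0Rw)) = record
      { size             = size
      ; class            = class′
      ; class-surjective = λ c → let (v , p) = class-surjective c in suc v , λ { refl → p refl }
      ; class-≡          = class′-≡
      }
      where
      class′ : Fin (suc n) → Fin size
      class′ zero    = class w
      class′ (suc v) = class v
      class′-≡ : ∀ u v → class′ u ≡ class′ v ⇔ R u v
      class′-≡ zero    zero    = mk⇔ (λ _ → R.refl) (λ _ → refl)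
      class′-≡ zero    (suc v) = mk⇔ (λ e → R.trans 0Rw (to e)) (λ r → from (R.trans (R.sym 0Rw) r))
      class′-≡ (suc u) zero    = mk⇔ (λ e → R.trans (to e) (R.sym 0Rw)) (λ r → from (R.trans r 0Rw))
      class′-≡ (suc u) (suc v) = class-≡ u v
    extend (no ¬0R) = record
      { size             = suc size
      ; class            = class′
      ; class-surjective = λ where
          zero    → zero , λ { refl → refl }
          (suc c) → let (v , p) = class-surjective c in suc v , λ { refl → cong suc (p refl) }
      ; class-≡          = class′-≡
      }
      where
      class′ : Fin (suc n) → Fin (suc size)
      class′ zero    = zero
      class′ (suc v) = suc (class v)
      class′-≡ : ∀ u v → class′ u ≡ class′ v ⇔ R u v
      class′-≡ zero    zero    = mk⇔ (λ _ → R.refl) (λ _ → refl)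
      class′-≡ zero    (suc v) = mk⇔ (λ ()) (λ r → contradiction (v , r) ¬0R)
      class′-≡ (suc u) zero    = mk⇔ (λ ()) (λ r → contradiction (u , R.sym r) ¬0R)
      class′-≡ (suc u) (suc v) = mk⇔ (to ∘ suc-injective) (cong suc ∘ from)

  -- Warshall's algorithm: Via ks u v says that there is a walk from u to v
  -- all of whose interior vertices are in ks.

  module _ (G : Graph) where
    open Graph G using (adj; _~_)

    Via : List (V G) → Rel (V G) 0ℓ
    Via []       u v = u ≡ v ⊎ u ~ v
    Via (k ∷ ks) u v = Via ks u v ⊎ (Via ks u k × Via ks k v)

    via? : ∀ ks → Decidable (Via ks)
    via? []       u v = (u ≟ v) ⊎-dec T? (adj u v)
    via? (k ∷ ks) u v = via? ks u v ⊎-dec (via? ks u k ×-dec via? ks k v)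

    via-edge : ∀ ks {u v} → u ≡ v ⊎ u ~ v → Via ks u v
    via-edge []       e = e
    via-edge (_ ∷ ks) e = inj₁ (via-edge ks e)

    via-sound : ∀ ks {u v} → Via ks u v → Connected G u v
    via-sound []       (inj₁ refl)    = ε
    via-sound []       (inj₂ e)       = e ◅ ε
    via-sound (_ ∷ ks) (inj₁ p)       = via-sound ks p
    via-sound (_ ∷ ks) (inj₂ (p , q)) = via-sound ks p ◅◅ via-sound ks q

    via-trans : ∀ ks {u k v} → k ∈ˡ ks → Via ks u k → Via ks k v → Via ks u v
    via-trans (_ ∷ _)  (here refl) p q = inj₂ (into p , out q)
      where
      into : ∀ {u k ks} → Via (k ∷ ks) u k → Via ks u k
      into (inj₁ p)       = p
      into (inj₂ (p , _)) = p
      out : ∀ {v k ks} → Via (k ∷ ks) k v → Via ks k v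
      out (inj₁ q)       = q
      out (inj₂ (_ , q)) = q
    via-trans (_ ∷ ks) (there k∈) (inj₁ p)        (inj₁ q)        = inj₁ (via-trans ks k∈ p q)
    via-trans (_ ∷ ks) (there k∈) (inj₁ p)        (inj₂ (q , q′)) = inj₂ (via-trans ks k∈ p q , q′)
    via-trans (_ ∷ ks) (there k∈) (inj₂ (p , p′)) (inj₁ q)        = inj₂ (p , via-trans ks k∈ p′ q)
    via-trans (_ ∷ ks) (there k∈) (inj₂ (p , _))  (inj₂ (_ , q′)) = inj₂ (p , q′)

    via-complete : ∀ {u v} → Connected G u v → Via (allFin (order G)) u v
    via-complete ε       = via-edge _ (inj₁ refl)
    via-complete (e ◅ p) = via-trans _ (∈-allFin _) (via-edge _ (inj₂ e)) (via-complete p)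

connected? : (G : Graph) → Decidable (Connected G)
connected? G u v = map′ (via-sound G _) (via-complete G) (via? G (allFin (order G)) u v)

connected-isEquivalence : (G : Graph) → IsEquivalence (Connected G)
connected-isEquivalence G = record
  { refl  = ε
  ; sym   = reverse (λ {u} {v} → subst T (Graph.adj-sym G u v))
  ; trans = _◅◅_
  }

components : (G : Graph) → Quotient (Connected G)
components G = quotient (connected-isEquivalence G) (connected? G)

c : Graph → ℕ
c G = Quotient.size (components G)

adh : (G : Graph) → V G → ℤ
adh G v = + c (G ∖ v) ℤ.- + c G ℤ.+ 1ℤ

#adh≥ : ℤ → Graph → ℕ
#adh≥ c₁ G = length (filter (λ v → c₁ ℤ.≤? adh G v) (allFin (order G)))

private
  does-sym : ∀ {n} (u v : Fin n) → does (u ≟ v) ≡ does (v ≟ u)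
  does-sym u v = does-⇔ (mk⇔ sym sym) (u ≟ v) (v ≟ u)

  does-refl : ∀ {n} (u : Fin n) → does (u ≟ u) ≡ true
  does-refl u = dec-true (u ≟ u) refl

complete : ℕ → Graph
complete n = record
  { order      = n
  ; adj        = λ u v → not (does (u ≟ v))
  ; adj-sym    = λ u v → cong not (does-sym u v)
  ; adj-irrefl = λ u → cong not (does-refl u)
  }

-- K_{1,n}, with centre zero.

star : ℕ → Graph
star n = record
  { order = suc n ; adj = adj ; adj-sym = adj-sym ; adj-irrefl = adj-irrefl }
  module StarGraph where
  adj : Fin (suc n) → Fin (suc n) → Bool
  adj zero    zero    = false
  adj zero    (suc _) = true
  adj (suc _) zero    = true
  adj (suc _) (suc _) = false
  adj-sym : ∀ u v → adj u v ≡ adj v u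
  adj-sym zero    zero    = refl
  adj-sym zero    (suc _) = refl
  adj-sym (suc _) zero    = refl
  adj-sym (suc _) (suc _) = refl
  adj-irrefl : ∀ u → adj u u ≡ false
  adj-irrefl zero    = refl
  adj-irrefl (suc _) = refl

-- The disjoint union nG; its vertices are the pairs (i , a) of an index
-- i : Fin n of a copy and a : V G, encoded by remQuot.

copies : ℕ → Graph → Graph
copies n G = record
  { order      = n * order G
  ; adj        = λ u v → pairAdj (split u) (split v)
  ; adj-sym    = λ u v → pairAdj-sym (split u) (split v)
  ; adj-irrefl = λ u → pairAdj-irrefl (split u)
  }
  module Copies where
  open Graph G using (adj; adj-sym; adj-irrefl)
  split : Fin (n * order G) → Fin n × V G
  split = remQuot (order G)
  pairAdj : Fin n × V G → Fin n × V G → Bool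
  pairAdj (i , a) (j , b) = does (i ≟ j) ∧ adj a b
  pairAdj-sym : ∀ x y → pairAdj x y ≡ pairAdj y x
  pairAdj-sym (i , a) (j , b) = cong₂ _∧_ (does-sym i j) (adj-sym a b)
  pairAdj-irrefl : ∀ x → pairAdj x x ≡ false
  pairAdj-irrefl (i , a) = cong₂ _∧_ (does-refl i) (adj-irrefl a)

-- G with k pendant vertices attached to every vertex: (a , zero) stands
-- for a itself and (a , suc p) for the pendant vertices at a.

attachPendants : ℕ → Graph → Graph
attachPendants k G = record
  { order      = order G * suc k
  ; adj        = λ u v → pairAdj (split u) (split v)
  ; adj-sym    = λ u v → pairAdj-sym (split u) (split v)
  ; adj-irrefl = λ u → pairAdj-irrefl (split u)
  }
  module AttachPendants where
  open Graph G using (adj; adj-sym; adj-irrefl)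
  split : Fin (order G * suc k) → V G × Fin (suc k)
  split = remQuot (suc k)
  pairAdj : V G × Fin (suc k) → V G × Fin (suc k) → Bool
  pairAdj (a , zero)  (b , zero)  = adj a b
  pairAdj (a , zero)  (b , suc _) = does (a ≟ b)
  pairAdj (a , suc _) (b , zero)  = does (a ≟ b)
  pairAdj (a , suc _) (b , suc _) = false
  pairAdj-sym : ∀ x y → pairAdj x y ≡ pairAdj y x
  pairAdj-sym (a , zero)  (b , zero)  = adj-sym a b
  pairAdj-sym (a , zero)  (b , suc _) = does-sym a b
  pairAdj-sym (a , suc _) (b , zero)  = does-sym a b
  pairAdj-sym (a , suc _) (b , suc _) = refl
  pairAdj-irrefl : ∀ x → pairAdj x x ≡ false
  pairAdj-irrefl (a , zero)  = adj-irrefl a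
  pairAdj-irrefl (a , suc _) = refl

nK₁,ₙ : ℕ → Graph
nK₁,ₙ n = copies n (star n)

Kₙⁿ : ℕ → Graph
Kₙⁿ n = attachPendants n (complete n)

{-# OPTIONS --safe #-}
-- nK_{1,n} and K_n^n are the graphs obtained by attaching n pendant vertices to
-- every vertex of an edgeless, respectively complete, graph on n vertices.  The
-- n vertices with pendants have adhesion at least n, which gives one direction.
--
-- Conversely, adh v is the number of components of G - v containing a neighbour
-- of v.  Among many vertices of adhesion at least 2n, Ramsey's theorem yields n
-- that are pairwise adjacent or pairwise nonadjacent.  For such a vertex v, at
-- most n of the components counted by adh v contain another of these vertices,
-- so v has neighbours in n components that do not.  These neighbours are private:
-- if w and w', chosen for v ≠ v', were equal or adjacent, then w' and hence its
-- neighbour v' would lie in the component of w in G - v.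
module Submission where

open import Defs
open import Axiom.ExcludedMiddle using (ExcludedMiddle)
open import Data.Bool.Base using (Bool; true; false; not; _∧_; T)
open import Data.Bool.Properties using (T?; T-≡; ∧-zeroʳ; ∧-identityʳ)
open import Data.Fin.Base using (Fin; zero; suc; punchOut; combine; remQuot; splitAt; join; fromℕ<)
open import Data.Fin.Properties
  using (_≟_; any?; suc-injective; punchIn-injective; punchInᵢ≢i; punchIn-punchOut;
         injective⇒≤; join-splitAt; combine-remQuot; remQuot-combine; combine-injectiveˡ)
open import Data.Integer.Base as ℤ using (ℤ; +_; ∣_∣; 1ℤ; +≤+)
import Data.Integer.Properties as ℤ
open import Data.Integer.Tactic.RingSolver using (solve-∀)
open import Data.List.Base using (List; length; lookup; filter; allFin)
open import Data.List.Membership.Propositional.Properties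
  using (∈-allFin; ∈-filter⁺; ∈-filter⁻; ∈-lookup)
open import Data.List.Membership.Setoid.Properties using (index-injective)
open import Data.List.Relation.Unary.All as All using ()
open import Data.List.Relation.Unary.AllPairs.Core using (_∷_)
open import Data.List.Relation.Unary.Unique.Propositional using (Unique)
open import Data.List.Relation.Unary.Unique.Propositional.Properties using (filter⁺; allFin⁺)
open import Data.Nat.Base using (ℕ; zero; suc; pred; _+_; _<_; _>_; _≤_; z≤n; s≤s; >-nonZero)
import Data.Nat.Properties as ℕ
open import Data.Product.Base using (∃; ∃₂; _×_; _,_; proj₁; proj₂; uncurry)
open import Data.Sum.Base using (_⊎_; inj₁; inj₂; [_,_]′)
open import Function.Base using (_∘_; _$_)
open import Function.Bundles using (_⇔_; mk⇔; Equivalence)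
open import Function.Definitions using (Injective)
open import Level using (0ℓ)
open import Relation.Binary.Construct.Closure.ReflexiveTransitive using (ε; _◅_; _◅◅_; gmap)
open import Relation.Binary.Core using (Rel)
open import Relation.Binary.Definitions using (Decidable)
open import Relation.Binary.PropositionalEquality
  using (_≡_; _≢_; refl; sym; trans; cong; subst; subst₂; setoid)
open import Relation.Binary.Structures using (IsEquivalence)
open import Relation.Nullary using (¬_; Dec; yes; no; does; contradiction)
open import Relation.Nullary.Decidable using (_×-dec_; dec-true; decidable-stable; ¬?)
open import Relation.Unary using (Pred; _∈_; _∪_; ｛_｝; ∁)
import Relation.Unary as U

-- Counting

AtLeast : ∀ {ℓ n} → ℕ → Pred (Fin n) ℓ → Set ℓ
AtLeast {n = n} k P =
  ∃ λ (f : Fin k → Fin n) → Injective _≡_ _≡_ f × (∀ i → f i ∈ P)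

atLeast-zero : ∀ {ℓ n} (P : Pred (Fin n) ℓ) → AtLeast 0 P
atLeast-zero _ = (λ ()) , (λ { {()} }) , λ ()

atLeast-shift : ∀ {ℓ n k} (P : Pred (Fin (suc n)) ℓ) → AtLeast k (P ∘ suc) → AtLeast k P
atLeast-shift _ (f , inj , f∈) = suc ∘ f , inj ∘ suc-injective , f∈

atLeast-suc : ∀ {ℓ n k} (P : Pred (Fin (suc n)) ℓ) → zero ∈ P →
  AtLeast k (P ∘ suc) → AtLeast (suc k) P
atLeast-suc _ p₀ (f , inj , f∈) =
  (λ { zero → zero ; (suc i) → suc (f i) }) ,
  (λ { {zero} {zero} _ → refl ; {suc i} {suc j} e → cong suc (inj (suc-injective e)) }) ,
  λ { zero → p₀ ; (suc i) → f∈ i }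

-- If both alternatives failed, then a and b would be positive and n at most (a - 1) + (b - 1),
-- against the bound.
pigeonhole : ∀ {ℓ n} {P : Pred (Fin n) ℓ} → U.Decidable P → ∀ a b → a + b ≤ suc n →
  AtLeast a P ⊎ AtLeast b (∁ P)
pigeonhole {P = P} P? zero b _ = inj₁ (atLeast-zero P)
pigeonhole {P = P} P? (suc a) zero _ = inj₂ (atLeast-zero (∁ P))
pigeonhole {n = zero} P? (suc a) (suc b) (s≤s le) =
  contradiction (subst (_≤ 0) (ℕ.+-suc a b) le) λ ()
pigeonhole {n = suc n} {P} P? (suc a) (suc b) (s≤s le) with P? zero
... | yes p₀ =
  [ inj₁ ∘ atLeast-suc P p₀ , inj₂ ∘ atLeast-shift (∁ P) ]′ (pigeonhole (P? ∘ suc) a (suc b) le)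
... | no ¬p₀ =
  [ inj₁ ∘ atLeast-shift P , inj₂ ∘ atLeast-suc (∁ P) ¬p₀ ]′
    (pigeonhole (P? ∘ suc) (suc a) b (subst (_≤ suc n) (ℕ.+-suc a b) le))

lookup-injective : ∀ {a} {A : Set a} {xs : List A} → Unique xs →
  Injective _≡_ _≡_ (lookup xs)
lookup-injective (_ ∷ _) {zero} {zero} _ = refl
lookup-injective (x∉ ∷ _) {zero} {suc j} e = contradiction e (All.lookup x∉ (∈-lookup j))
lookup-injective (x∉ ∷ _) {suc i} {zero} e = contradiction (sym e) (All.lookup x∉ (∈-lookup i))
lookup-injective (_ ∷ uniq) {suc i} {suc j} e = cong suc (lookup-injective uniq e)

module _ {ℓ n} {P : Pred (Fin n) ℓ} (P? : U.Decidable P) where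

  filter-atLeast : AtLeast (length (filter P? (allFin n))) P
  filter-atLeast =
    lookup (filter P? (allFin n)) , lookup-injective (filter⁺ P? (allFin⁺ n)) ,
    λ i → proj₂ (∈-filter⁻ P? {xs = allFin n} (∈-lookup i))

  atLeast⇒≤filter : ∀ {k} → AtLeast k P → k ≤ length (filter P? (allFin n))
  atLeast⇒≤filter (f , inj , f∈) =
    -- The position of `f i` in the filtered list determines `f i`, hence `i`.
    injective⇒≤ (λ e → inj (index-injective (setoid _) (f∈filter _) (f∈filter _) e))
    where
    f∈filter : ∀ i → _
    f∈filter i = ∈-filter⁺ P? (∈-allFin (f i)) (f∈ i)

-- Induced subgraphs and Ramsey's theorem

⊑-trans : ∀ G₁ G₂ G₃ → G₁ ⊑ G₂ → G₂ ⊑ G₃ → G₁ ⊑ G₃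
⊑-trans _ _ _ (f , f-inj , f-adj) (g , g-inj , g-adj) =
  g ∘ f , f-inj ∘ g-inj , λ u v → trans (f-adj u v) (g-adj (f u) (f v))

-- For injective `s`, this is the subgraph induced by the image of `s`, relabelled by `Fin k`.
induced : (G : Graph) {k : ℕ} → (Fin k → V G) → Graph
induced G {k} s = record
  { order = k
  ; adj = λ i j → adj (s i) (s j)
  ; adj-sym = λ i j → adj-sym (s i) (s j)
  ; adj-irrefl = λ i → adj-irrefl (s i)
  }
  where open Graph G using (adj; adj-sym; adj-irrefl)

others-injective : ∀ {n} (v : Fin n) → Injective _≡_ _≡_ (others v)
others-injective {suc n} v = punchIn-injective v _ _

others≢ : ∀ {n} (v : Fin n) x → others v x ≢ v
others≢ {suc n} = punchInᵢ≢i

others⁻¹ : ∀ {n} {v u : Fin n} → u ≢ v → ∃ λ x → others v x ≡ u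
others⁻¹ {suc n} u≢v = punchOut (u≢v ∘ sym) , punchIn-punchOut (u≢v ∘ sym)

¬T⇒≡false : ∀ {x} → ¬ T x → x ≡ false
¬T⇒≡false {false} _ = refl
¬T⇒≡false {true} ¬t = contradiction _ ¬t

edgeless : ℕ → Graph
edgeless n = record
  { order = n
  ; adj = λ _ _ → false
  ; adj-sym = λ _ _ → refl
  ; adj-irrefl = λ _ → refl
  }

-- complete n ⊑ G for b = true and edgeless n ⊑ G for b = false.
Homogeneous : Bool → ℕ → Graph → Set
Homogeneous b n G = ∃ λ (f : Fin n → V G) →
  Injective _≡_ _≡_ f × (∀ i j → b ∧ not (does (i ≟ j)) ≡ Graph.adj G (f i) (f j))

homogeneous-zero : ∀ {b} G → Homogeneous b 0 G
homogeneous-zero G = (λ ()) , (λ { {()} }) , λ ()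

homogeneous-induced : ∀ {b n k} G {s : Fin k → V G} → Injective _≡_ _≡_ s →
  Homogeneous b n (induced G s) → Homogeneous b n G
homogeneous-induced G {s} s-inj (f , f-inj , f-adj) = s ∘ f , f-inj ∘ s-inj , f-adj

-- The Ramsey induction step: `s` lists neighbours of `v` if `b` is true and non-neighbours if it is
-- false, so `v` extends a homogeneous set found among them.
homogeneous-suc : ∀ {b n k} G (v : V G) {s : Fin k → V G} → Injective _≡_ _≡_ s →
  (∀ i → s i ≢ v) → (∀ i → Graph.adj G v (s i) ≡ b) →
  Homogeneous b n (induced G s) → Homogeneous b (suc n) G
homogeneous-suc {b} {n} G v {s} s-inj s≢v s-adj (f , f-inj , f-adj) = g , g-inj , g-adj
  where
  open Graph G using (adj; adj-sym; adj-irrefl)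
  g : Fin (suc n) → V G
  g zero = v
  g (suc i) = s (f i)
  g-inj : Injective _≡_ _≡_ g
  g-inj {zero} {zero} _ = refl
  g-inj {zero} {suc j} e = contradiction (sym e) (s≢v (f j))
  g-inj {suc i} {zero} e = contradiction e (s≢v (f i))
  g-inj {suc i} {suc j} e = cong suc (f-inj (s-inj e))
  g-adj : ∀ i j → b ∧ not (does (i ≟ j)) ≡ adj (g i) (g j)
  g-adj zero zero = trans (∧-zeroʳ b) (sym (adj-irrefl v))
  g-adj zero (suc j) = trans (∧-identityʳ b) (sym (s-adj (f j)))
  g-adj (suc i) zero = trans (∧-identityʳ b) (sym (trans (adj-sym _ v) (s-adj (f i))))
  g-adj (suc i) (suc j) = f-adj i j

-- The Erdős-Szekeres recursion with one vertex added, which ensures a vertex to start from even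
-- when both summands vanish.
ramseyNumber : ℕ → ℕ → ℕ
ramseyNumber zero _ = 0
ramseyNumber (suc a) zero = 0
ramseyNumber (suc a) (suc b) = suc (ramseyNumber a (suc b) + ramseyNumber (suc a) b)

-- Fix a vertex `v`. It has many neighbours or many non-neighbours; the induction hypothesis there
-- gives one of the two graphs outright or one that `v` enlarges.
ramsey : ∀ a b G → ramseyNumber a b ≤ order G → Homogeneous true a G ⊎ Homogeneous false b G
ramsey zero b G _ = inj₁ (homogeneous-zero G)
ramsey (suc a) zero G _ = inj₂ (homogeneous-zero G)
ramsey (suc a) (suc b) G N≤ = extend $
  pigeonhole (λ x → T? (adj v (others v x))) (ramseyNumber a (suc b)) (ramseyNumber (suc a) b)
    -- The pigeonhole runs over the `pred (order G)` vertices other than `v`, so its bound is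
    -- `order G` itself.
    (ℕ.≤-trans (ℕ.<⇒≤ N≤) (ℕ.≤-reflexive (sym (ℕ.suc-pred (order G) {{>-nonZero 0<}}))))
  where
  open Graph G using (adj)
  0< : 0 < order G
  0< = ℕ.≤-trans (s≤s z≤n) N≤
  v : V G
  v = fromℕ< 0<
  extend : _ ⊎ _ → Homogeneous true (suc a) G ⊎ Homogeneous false (suc b) G
  extend (inj₁ (s , s-inj , s∈)) =
    [ inj₁ ∘ homogeneous-suc G v inj (λ i → others≢ v (s i)) (λ i → Equivalence.to T-≡ (s∈ i))
    , inj₂ ∘ homogeneous-induced G inj
    ]′ (ramsey a (suc b) (induced G (others v ∘ s)) ℕ.≤-refl)
    where
    inj : Injective _≡_ _≡_ (others v ∘ s)
    inj e = s-inj (others-injective v e)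
  extend (inj₂ (s , s-inj , s∉)) =
    [ inj₁ ∘ homogeneous-induced G inj
    , inj₂ ∘ homogeneous-suc G v inj (λ i → others≢ v (s i)) (λ i → ¬T⇒≡false (s∉ i))
    ]′ (ramsey (suc a) b (induced G (others v ∘ s)) ℕ.≤-refl)
    where
    inj : Injective _≡_ _≡_ (others v ∘ s)
    inj e = s-inj (others-injective v e)

-- Adhesion

-- Adding `c G` to both sides clears the subtraction, so that component counts can be compared by
-- injections.
+≤-adh : ∀ k G v → (+ k ℤ.≤ adh G v) ⇔ (k + c G ≤ suc (c (G ∖ v)))
+≤-adh k G v = mk⇔
  (λ le → ℤ.drop‿+≤+ (subst (+ (k + c G) ℤ.≤_) (adh+c (+ c (G ∖ v)) (+ c G))
    (ℤ.+-monoˡ-≤ (+ c G) le)))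
  (λ le → subst₂ ℤ._≤_ (k+c-c (+ k) (+ c G)) (suc-c (+ c (G ∖ v)) (+ c G))
    (ℤ.+-monoˡ-≤ (ℤ.- + c G) (+≤+ le)))
  where
  adh+c : ∀ i j → (i ℤ.- j ℤ.+ 1ℤ) ℤ.+ j ≡ 1ℤ ℤ.+ i
  adh+c = solve-∀
  k+c-c : ∀ i j → i ℤ.+ j ℤ.- j ≡ i
  k+c-c = solve-∀
  suc-c : ∀ i j → 1ℤ ℤ.+ i ℤ.- j ≡ i ℤ.- j ℤ.+ 1ℤ
  suc-c = solve-∀

module _ (G : Graph) where
  open Graph G using (adj; adj-sym; adj-irrefl; _~_)

  adjacent⇒≢ : ∀ {u v} → u ~ v → u ≢ v
  adjacent⇒≢ {u} u~u refl = subst T (adj-irrefl u) u~u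

  ~-sym : ∀ {u v} → u ~ v → v ~ u
  ~-sym {u} {v} = subst T (adj-sym u v)

  -- The components of G - v seen from `V G`, which avoids renumbering vertices. It is a partial
  -- equivalence: `v` is linked to nothing.
  Linked : V G → Rel (V G) 0ℓ
  Linked v u u′ = ∃₂ λ x x′ → others v x ≡ u × others v x′ ≡ u′ × Connected (G ∖ v) x x′

  linked? : ∀ v → Decidable (Linked v)
  linked? v u u′ = any? λ x → any? λ x′ →
    (others v x ≟ u) ×-dec (others v x′ ≟ u′) ×-dec connected? (G ∖ v) x x′

  module _ {v : V G} where

    linked-refl : ∀ {u} → u ≢ v → Linked v u u
    linked-refl u≢v = let (x , e) = others⁻¹ u≢v in x , x , e , e , ε

    linked-sym : ∀ {u u′} → Linked v u u′ → Linked v u′ u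
    linked-sym (x , x′ , e , e′ , p) =
      x′ , x , e′ , e , IsEquivalence.sym (connected-isEquivalence (G ∖ v)) p

    linked-trans : ∀ {u u′ u″} → Linked v u u′ → Linked v u′ u″ → Linked v u u″
    linked-trans (x , x′ , e , e′ , p) (y , y′ , d , d′ , q)
      with refl ← others-injective v (trans e′ (sym d)) = x , y′ , e , d′ , p ◅◅ q

    linked⇒≢ : ∀ {u u′} → Linked v u u′ → u′ ≢ v
    linked⇒≢ (_ , x′ , _ , refl , _) = others≢ v x′

    linked⇒connected : ∀ {u u′} → Linked v u u′ → Connected G u u′
    linked⇒connected (x , x′ , refl , refl , p) = gmap (others v) (λ e → e) p

    linked-edge : ∀ {u u′} → u ≢ v → u′ ≢ v → u ~ u′ → Linked v u u′
    linked-edge u≢v u′≢v u~u′ with others⁻¹ u≢v | others⁻¹ u′≢v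
    ... | x , refl | x′ , refl = x , x′ , refl , refl , u~u′ ◅ ε

    -- A walk either avoids v or is cut at a neighbour of v.
    connected⇒linked : ∀ {u u′} → u ≢ v → Connected G u u′ →
      Linked v u u′ ⊎ ∃ λ w → v ~ w × Linked v u w
    connected⇒linked u≢v ε = inj₁ (linked-refl u≢v)
    connected⇒linked u≢v (_◅_ {j = z} e p) with z ≟ v
    ... | yes refl = inj₂ (_ , ~-sym e , linked-refl u≢v)
    ... | no z≢v with connected⇒linked z≢v p
    ...   | inj₁ l = inj₁ (linked-trans (linked-edge u≢v z≢v e) l)
    ...   | inj₂ (w , v~w , l) = inj₂ (w , v~w , linked-trans (linked-edge u≢v z≢v e) l)

  -- Neighbours of `v` in k different components of G - v. The next two lemmas show that they exist
  -- exactly when the adhesion of `v` is at least k.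
  SeparatedNeighbours : ℕ → V G → Set
  SeparatedNeighbours k v = ∃ λ (w : Fin k → V G) →
    (∀ p → v ~ w p) × (∀ {p q} → Linked v (w p) (w q) → p ≡ q)

  module _ (v : V G) where
    private
      module Q = Quotient (components G)
      module Q∖ = Quotient (components (G ∖ v))

      class⇒connected : ∀ {u u′} → Q.class u ≡ Q.class u′ → Connected G u u′
      class⇒connected = Equivalence.to (Q.class-≡ _ _)

      connected⇒class : ∀ {u u′} → Connected G u u′ → Q.class u ≡ Q.class u′
      connected⇒class = Equivalence.from (Q.class-≡ _ _)

    adh≥⇒separated : ∀ {k} → + k ℤ.≤ adh G v → SeparatedNeighbours k v
    adh≥⇒separated {k} k≤adh =
      [ (λ many → contradiction (tooMany many) ℕ.1+n≰n) , choose ]′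
        -- By the adhesion bound, the thresholds `Q.size` and `k` add up to at most one more than
        -- the number of components of G - v.
        (pigeonhole (λ d → ¬? (hasNbr? d)) Q.size k
          (subst (_≤ suc Q∖.size) (ℕ.+-comm k Q.size) (Equivalence.to (+≤-adh k G v) k≤adh)))
      where
      HasNbr : Pred (Fin Q∖.size) 0ℓ
      HasNbr d = ∃ λ x → v ~ others v x × Q∖.class x ≡ d

      hasNbr? : U.Decidable HasNbr
      hasNbr? d = any? λ x → T? (adj v (others v x)) ×-dec (Q∖.class x ≟ d)

      choose : AtLeast k (∁ (∁ HasNbr)) → SeparatedNeighbours k v
      choose (f , f-inj , f∈) = others v ∘ proj₁ ∘ nbr , proj₁ ∘ proj₂ ∘ nbr , separated
        where
        nbr : ∀ p → HasNbr (f p)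
        nbr p = decidable-stable (hasNbr? (f p)) (f∈ p)
        separated : ∀ {p q} → Linked v (others v (proj₁ (nbr p))) (others v (proj₁ (nbr q))) → p ≡ q
        separated {p} {q} (x , y , e , d , l)
          with refl ← others-injective v e | refl ← others-injective v d =
          f-inj (trans (sym (proj₂ (proj₂ (nbr p))))
                  (trans (Equivalence.from (Q∖.class-≡ _ _) l) (proj₂ (proj₂ (nbr q)))))

      -- A component of G ∖ v without neighbours of v is a component of G,
      -- different from that of v.
      tooMany : AtLeast Q.size (∁ HasNbr) → suc Q.size ≤ Q.size
      tooMany (f , f-inj , f∉) = injective⇒≤ {f = g} g-inj
        where
        r : Fin Q.size → Fin (pred (order G))
        r i = proj₁ (Q∖.class-surjective (f i))
        class-r : ∀ i → Q∖.class (r i) ≡ f i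
        class-r i = proj₂ (Q∖.class-surjective (f i)) refl
        noNbr : ∀ i {w} → v ~ w → ¬ Linked v (others v (r i)) w
        noNbr i v~w (x , y , e , refl , l) with refl ← others-injective v e =
          f∉ i (y , v~w , trans (sym (Equivalence.from (Q∖.class-≡ _ _) l)) (class-r i))
        r-linked : ∀ i {u} → Connected G (others v (r i)) u → Linked v (others v (r i)) u
        r-linked i p = [ (λ l → l) , (λ (_ , v~w , l) → contradiction l (noNbr i v~w)) ]′
          (connected⇒linked (others≢ v (r i)) p)
        r≁v : ∀ i → Q.class (others v (r i)) ≢ Q.class v
        r≁v i e = linked⇒≢ (r-linked i (class⇒connected e)) refl
        g : Fin (suc Q.size) → Fin Q.size
        g zero = Q.class v
        g (suc i) = Q.class (others v (r i))
        g-inj : Injective _≡_ _≡_ g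
        g-inj {zero} {zero} _ = refl
        g-inj {zero} {suc j} e = contradiction (sym e) (r≁v j)
        g-inj {suc i} {zero} e = contradiction e (r≁v i)
        g-inj {suc i} {suc j} e with r-linked i (class⇒connected e)
        ... | x , y , d , d′ , l
          with refl ← others-injective v d | refl ← others-injective v d′ =
          cong suc (f-inj (trans (sym (class-r i))
            (trans (Equivalence.from (Q∖.class-≡ _ _) l) (class-r j))))

    -- The k neighbours and one representative of each component of G receive different codes, so k
    -- + c(G) is at most c(G - v) + 1.
    separated⇒adh≥ : ∀ {k} → SeparatedNeighbours k v → + k ℤ.≤ adh G v
    separated⇒adh≥ {k} (w , v~w , w-sep) =
      Equivalence.from (+≤-adh k G v) (injective⇒≤ {f = code ∘ vertex ∘ splitAt k}
        (λ {i} {j} e → trans (sym (join-splitAt k Q.size i))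
          (trans (cong (join k Q.size) (vertex-inj (splitAt k i) (splitAt k j) (code-inj _ _ e)))
            (join-splitAt k Q.size j))))
      where
      -- The code `zero` is reserved for `v`; any other vertex is coded by its component in G - v.
      code′ : ∀ {u} → Dec (u ≡ v) → Fin (suc Q∖.size)
      code′ (yes _) = zero
      code′ (no u≢v) = suc (Q∖.class (proj₁ (others⁻¹ u≢v)))

      code : V G → Fin (suc Q∖.size)
      code u = code′ (u ≟ v)

      code-inj : ∀ u u′ → code u ≡ code u′ → (u ≡ v × u′ ≡ v) ⊎ Linked v u u′
      code-inj u u′ e with u ≟ v | u′ ≟ v
      ... | yes p | yes q = inj₁ (p , q)
      ... | no p | no q = inj₂
        (_ , _ , proj₂ (others⁻¹ p) , proj₂ (others⁻¹ q) ,
         Equivalence.to (Q∖.class-≡ _ _) (suc-injective e))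

      -- The component of v is represented by v itself.
      rep′ : ∀ {d} → Dec (d ≡ Q.class v) → V G
      rep′ (yes _) = v
      rep′ {d} (no _) = proj₁ (Q.class-surjective d)

      vertex : Fin k ⊎ Fin Q.size → V G
      vertex (inj₁ p) = w p
      vertex (inj₂ d) = rep′ (d ≟ Q.class v)

      class-rep : ∀ d → Q.class (vertex (inj₂ d)) ≡ d
      class-rep d with d ≟ Q.class v
      ... | yes e = sym e
      ... | no _ = proj₂ (Q.class-surjective d) refl

      rep-v : ∀ d → d ≡ Q.class v → vertex (inj₂ d) ≡ v
      rep-v d e with d ≟ Q.class v
      ... | yes _ = refl
      ... | no ≢ = contradiction e ≢

      -- As `w p` is adjacent to `v`, a representative linked to it would represent the component of
      -- `v` and thus be `v`, which is linked to nothing.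
      w≁rep : ∀ p d → ¬ Linked v (w p) (vertex (inj₂ d))
      w≁rep p d l = linked⇒≢ l
        (rep-v d (trans (sym (class-rep d)) (sym (connected⇒class (v~w p ◅ linked⇒connected l)))))

      vertex-inj : ∀ x y →
        (vertex x ≡ v × vertex y ≡ v) ⊎ Linked v (vertex x) (vertex y) → x ≡ y
      vertex-inj (inj₁ p) _ (inj₁ (e , _)) = contradiction (sym e) (adjacent⇒≢ (v~w p))
      vertex-inj (inj₂ _) (inj₁ q) (inj₁ (_ , e)) = contradiction (sym e) (adjacent⇒≢ (v~w q))
      vertex-inj (inj₁ p) (inj₁ q) (inj₂ l) = cong inj₁ (w-sep l)
      vertex-inj (inj₁ p) (inj₂ d) (inj₂ l) = contradiction l (w≁rep p d)
      vertex-inj (inj₂ d) (inj₁ q) (inj₂ l) = contradiction (linked-sym l) (w≁rep q d)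
      vertex-inj (inj₂ d) (inj₂ d′) (inj₁ (e , e′)) = cong inj₂
        (trans (sym (class-rep d)) (trans (cong Q.class (trans e (sym e′))) (class-rep d′)))
      vertex-inj (inj₂ d) (inj₂ d′) (inj₂ l) = cong inj₂
        (trans (sym (class-rep d)) (trans (connected⇒class (linked⇒connected l)) (class-rep d′)))

-- Graphs with pendant vertices

module _ (k : ℕ) (B : Graph) where
  open AttachPendants k B using (split; pairAdj)
  private
    A : Graph
    A = attachPendants k B

    vertex : V B → Fin (suc k) → V A
    vertex = combine

    split-vertex : ∀ a t → split (vertex a t) ≡ (a , t)
    split-vertex = remQuot-combine

  centre : V B → V A
  centre a = vertex a zero

  -- Deleting the centre isolates its pendant vertices, so they are k neighbours in different
  -- components.
  centre-adh : ∀ a → + k ℤ.≤ adh A (centre a)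
  centre-adh a = separated⇒adh≥ A (centre a) (leaf , centre~leaf , separated)
    where
    open Graph A using (_~_)
    leaf : Fin k → V A
    leaf p = vertex a (suc p)

    centre~leaf : ∀ p → centre a ~ leaf p
    centre~leaf p rewrite split-vertex a zero | split-vertex a (suc p) =
      Equivalence.from T-≡ (dec-true (a ≟ a) refl)

    leaf-inj : ∀ {p q} → leaf p ≡ leaf q → p ≡ q
    leaf-inj {p} {q} e
      with refl ← trans (sym (split-vertex a (suc p))) (trans (cong split e) (split-vertex a (suc q))) =
      refl

    leaf-nbr : ∀ p u → leaf p ~ u → u ≡ centre a
    leaf-nbr p u e rewrite split-vertex a (suc p) = trans (sym (combine-remQuot {order B} (suc k) u))
      (cong (uncurry combine) (at (split u) e))
      where
      at : ∀ y → T (pairAdj (a , suc p) y) → y ≡ (a , zero)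
      at (b , zero) e with a ≟ b
      ... | yes refl = refl

    separated : ∀ {p q} → Linked A (centre a) (leaf p) (leaf q) → p ≡ q
    separated (x , .x , e , e′ , ε) = leaf-inj (trans (sym e) e′)
    -- The first edge of a nontrivial walk from a leaf leads to the centre, which has been deleted.
    separated {p} (x , _ , e , _ , _◅_ {j = y} d _) =
      contradiction (leaf-nbr p (others (centre a) y) (subst (_~ others (centre a) y) e d))
        (others≢ (centre a) y)

  centres-adh : ∀ {c₁} → c₁ ℤ.≤ + k → order B ≤ #adh≥ c₁ A
  centres-adh {c₁} c₁≤k = atLeast⇒≤filter (λ v → c₁ ℤ.≤? adh A v)
    (centre , combine-injectiveˡ _ _ _ _ , λ a → ℤ.≤-trans c₁≤k (centre-adh a))

-- Embedding graphs with pendant vertices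

module PendantEmbedding (k : ℕ) {B G : Graph} {s : V B → V G} (s-inj : Injective _≡_ _≡_ s)
  (s-adj : ∀ a b → Graph.adj B a b ≡ Graph.adj G (s a) (s b)) where
  open Graph G using (adj; adj-sym; _~_)

  PrivateNeighbours : V B → Set
  PrivateNeighbours a = ∃ λ ((w , _) : SeparatedNeighbours G k (s a)) →
    ∀ p b → ¬ Linked G (s a) (w p) (s b)

  -- Each `s b` lies in at most one component of G - s a, so at most `order B` of the `order B + k`
  -- separated neighbours share a component with some `s b`.
  adh≥⇒private : ∀ a → + (order B + k) ℤ.≤ adh G (s a) → PrivateNeighbours a
  adh≥⇒private a s-adh = [ (λ many → contradiction (tooMany many) ℕ.1+n≰n) , choose ]′
    (pigeonhole (λ p → any? λ b → linked? G (s a) (w p) (s b)) (suc (order B)) k ℕ.≤-refl)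
    where
    nbrs : SeparatedNeighbours G (order B + k) (s a)
    nbrs = adh≥⇒separated G (s a) s-adh

    w : Fin (order B + k) → V G
    w = proj₁ nbrs

    w-sep : ∀ {p q} → Linked G (s a) (w p) (w q) → p ≡ q
    w-sep = proj₂ (proj₂ nbrs)

    Bad : Pred (Fin (order B + k)) 0ℓ
    Bad p = ∃ λ b → Linked G (s a) (w p) (s b)

    choose : AtLeast k (∁ Bad) → PrivateNeighbours a
    choose (g , g-inj , g∉) =
      (w ∘ g , proj₁ (proj₂ nbrs) ∘ g , λ l → g-inj (w-sep l)) , λ p b l → g∉ p (b , l)

    tooMany : AtLeast (suc (order B)) Bad → suc (order B) ≤ order B
    tooMany (g , g-inj , g∈) = injective⇒≤ {f = proj₁ ∘ g∈} λ {i} {j} e →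
      g-inj (w-sep (linked-trans G (proj₂ (g∈ i))
        (linked-sym G (subst (λ b → Linked G (s a) (w (g j)) (s b)) (sym e) (proj₂ (g∈ j))))))

  module _ (private-neighbours : ∀ a → PrivateNeighbours a) where
    open AttachPendants k B using (split; pairAdj)

    attachPendants-⊑ : attachPendants k B ⊑ G
    attachPendants-⊑ = f ∘ split , f-inj , λ x y → f-adj (split x) (split y)
      where
      w : V B → Fin k → V G
      w a = proj₁ (proj₁ (private-neighbours a))

      s~w : ∀ a p → s a ~ w a p
      s~w a = proj₁ (proj₂ (proj₁ (private-neighbours a)))

      w-sep : ∀ {a p q} → Linked G (s a) (w a p) (w a q) → p ≡ q
      w-sep {a} = proj₂ (proj₂ (proj₁ (private-neighbours a)))

      w-private : ∀ {a p b} → ¬ Linked G (s a) (w a p) (s b)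
      w-private {a} = proj₂ (private-neighbours a) _ _

      w≢s : ∀ {a p} → w a p ≢ s a
      w≢s {a} {p} e = adjacent⇒≢ G (s~w a p) (sym e)

      -- Equality and adjacency both put two vertices other than `v` in one component of G - v, so
      -- injectivity and nonadjacency of the images are proved together.
      Touch : Rel (V G) 0ℓ
      Touch u u′ = u ≡ u′ ⊎ u ~ u′

      touch⇒linked : ∀ {v u u′} → u ≢ v → u′ ≢ v → Touch u u′ → Linked G v u u′
      touch⇒linked u≢v _ (inj₁ refl) = linked-refl G u≢v
      touch⇒linked u≢v u′≢v (inj₂ e) = linked-edge G u≢v u′≢v e

      -- If `a` and `b` differed, `s b` would survive in G - s a and lie in the component of
      -- `w a p`, which is private.
      w-s : ∀ {a p b} → Touch (w a p) (s b) → a ≡ b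
      w-s {a} {p} {b} t with a ≟ b
      ... | yes a≡b = a≡b
      ... | no a≢b = contradiction (touch⇒linked w≢s (a≢b ∘ sym ∘ s-inj) t) w-private

      -- For different `a` and `b`, the neighbour `s b` of `w b q` would be linked to `w a p` in G -
      -- s a, against privacy. For equal ones, separation applies.
      w-w : ∀ {a p b q} → Touch (w a p) (w b q) → _≡_ {A = V B × Fin (suc k)} (a , suc p) (b , suc q)
      w-w {a} {p} {b} {q} t with a ≟ b
      ... | yes refl = cong (λ p → a , suc p) (w-sep (touch⇒linked w≢s w≢s t))
      ... | no a≢b = contradiction
        (linked-trans G (touch⇒linked w≢s wb≢sa t)
          (linked-edge G wb≢sa (a≢b ∘ sym ∘ s-inj) (~-sym G (s~w b q))))
        w-private
        where
        wb≢sa : w b q ≢ s a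
        wb≢sa e = a≢b (sym (w-s (inj₁ e)))

      f : V B × Fin (suc k) → V G
      f (a , zero) = s a
      f (a , suc p) = w a p

      f-inj′ : ∀ x y → f x ≡ f y → x ≡ y
      f-inj′ (a , zero) (b , zero) e = cong (_, zero) (s-inj e)
      f-inj′ (a , zero) (b , suc q) e with refl ← w-s (inj₁ (sym e)) = contradiction (sym e) w≢s
      f-inj′ (a , suc p) (b , zero) e with refl ← w-s (inj₁ e) = contradiction e w≢s
      f-inj′ (a , suc p) (b , suc q) e = w-w (inj₁ e)

      f-inj : Injective _≡_ _≡_ (f ∘ split)
      f-inj {x} {y} e = trans (sym (combine-remQuot {order B} (suc k) x))
        (trans (cong (uncurry combine) (f-inj′ (split x) (split y) e))
          (combine-remQuot {order B} (suc k) y))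

      s-w-adj : ∀ a b q → does (a ≟ b) ≡ adj (s a) (w b q)
      s-w-adj a b q with a ≟ b
      ... | yes refl = sym (Equivalence.to T-≡ (s~w a q))
      ... | no a≢b = sym $ ¬T⇒≡false (λ e → a≢b (sym (w-s (inj₂ (~-sym G e)))))

      f-adj : ∀ x y → pairAdj x y ≡ adj (f x) (f y)
      f-adj (a , zero) (b , zero) = s-adj a b
      f-adj (a , zero) (b , suc q) = s-w-adj a b q
      f-adj (a , suc p) (b , zero) =
        trans (AttachPendants.pairAdj-sym k B (a , suc p) (b , zero))
          (trans (s-w-adj b a p) (adj-sym (s b) (w a p)))
      -- Adjacent images would have equal indices, making a vertex adjacent to itself.
      f-adj (a , suc p) (b , suc q) = sym $ ¬T⇒≡false λ e → adjacent⇒≢ G e (cong f (w-w (inj₂ e)))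

-- Stars as pendant graphs, and the equivalence

copies-star-adj : ∀ n k x y →
  Copies.pairAdj n (star k) x y ≡ AttachPendants.pairAdj k (edgeless n) x y
copies-star-adj n k (i , zero) (j , zero) = ∧-zeroʳ _
copies-star-adj n k (i , zero) (j , suc _) = ∧-identityʳ _
copies-star-adj n k (i , suc _) (j , zero) = ∧-identityʳ _
copies-star-adj n k (i , suc _) (j , suc _) = ∧-zeroʳ _

-- Both graphs decode the same vertex set by the same `remQuot`, with `zero` marking the centres, so
-- the identity is an isomorphism.
nK₁,ₙ⊑ : ∀ n → nK₁,ₙ n ⊑ attachPendants n (edgeless n)
nK₁,ₙ⊑ n = (λ x → x) , (λ e → e) , λ x y →
  copies-star-adj n n (remQuot (suc n) x) (remQuot (suc n) y)

⊑nK₁,ₙ : ∀ n → attachPendants n (edgeless n) ⊑ nK₁,ₙ n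
⊑nK₁,ₙ n = (λ x → x) , (λ e → e) , λ x y →
  sym (copies-star-adj n n (remQuot (suc n) x) (remQuot (suc n) y))

theorem1p10 : ∀ {ℓ} → ExcludedMiddle ℓ → (ℋ : Pred Graph ℓ) →
    (∃ λ (c₁ : ℤ) → ∃ λ (c₂ : ℕ) → ∀ G → G ∈ ℋ -Free → #adh≥ c₁ G < c₂)
    ⇔
    (∃ λ (n : ℕ) → n > 0 × ℋ ⊑ᶠ (｛ nK₁,ₙ n ｝ ∪ ｛ Kₙⁿ n ｝))
theorem1p10 em ℋ = mk⇔ bounded⇒⊑ᶠ ⊑ᶠ⇒bounded
  where
  bounded⇒⊑ᶠ : _ → _
  bounded⇒⊑ᶠ (c₁ , c₂ , bound) = n , s≤s z≤n , λ where
      _ (inj₁ refl) →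
        let (H , H∈ , H⊑) = notFree (edgeless n) refl in
        H , H∈ , ⊑-trans H (attachPendants n (edgeless n)) (nK₁,ₙ n) H⊑ (⊑nK₁,ₙ n)
      _ (inj₂ refl) → notFree (complete n) refl
    where
    n : ℕ
    -- Positive, at least `c₁` for the adhesion of the centres, and at least `c₂` for their number.
    n = suc (∣ c₁ ∣ + c₂)

    c₁≤n : c₁ ℤ.≤ + n
    c₁≤n = ℤ.≤-trans (i≤∣i∣ c₁) (+≤+ (ℕ.m≤n⇒m≤1+n (ℕ.m≤m+n _ c₂)))
      where
      i≤∣i∣ : ∀ i → i ℤ.≤ + ∣ i ∣
      i≤∣i∣ (+ _) = ℤ.≤-refl
      i≤∣i∣ ℤ.-[1+ _ ] = ℤ.-≤+

    notFree : ∀ B → order B ≡ n → ∃ λ H → H ∈ ℋ × H ⊑ attachPendants n B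
    -- The n centres violate the bound, so the graph is not free of `ℋ`; excluded middle then yields
    -- a member of `ℋ` contained in it.
    notFree B refl = decidable-stable em λ free → ℕ.<⇒≱ (bound (attachPendants n B) free)
      (ℕ.≤-trans (ℕ.m≤n⇒m≤1+n (ℕ.m≤n+m c₂ ∣ c₁ ∣)) (centres-adh n B c₁≤n))

  ⊑ᶠ⇒bounded : _ → _
  ⊑ᶠ⇒bounded (n , _ , ℋ⊑) = c₁ , ramseyNumber n n , λ G free → ℕ.≰⇒> (bound G free)
    where
    c₁ : ℤ
    -- One n for the components met by the n chosen vertices, the other for the n private neighbours
    -- that remain.
    c₁ = + (n + n)

    attach : ∀ {G} B {s : V B → V G} → Injective _≡_ _≡_ s →
      (∀ a b → Graph.adj B a b ≡ Graph.adj G (s a) (s b)) →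
      (∀ a → + (order B + n) ℤ.≤ adh G (s a)) → attachPendants n B ⊑ G
    attach {G} B s-inj s-adj s-adh = attachPendants-⊑ (λ a → adh≥⇒private a (s-adh a))
      where open PendantEmbedding n {B} {G} s-inj s-adj

    bound : ∀ G → G ∈ ℋ -Free → ¬ (ramseyNumber n n ≤ #adh≥ c₁ G)
    -- `s` enumerates the vertices of large adhesion, and Ramsey's theorem is applied to the
    -- subgraph that they induce.
    bound G free N≤ with filter-atLeast (λ v → c₁ ℤ.≤? adh G v)
    ... | s , s-inj , s-adh with ramsey n n (induced G s) N≤
    ...   | inj₁ (f , f-inj , f-adj) =
      let (H , H∈ , H⊑) = ℋ⊑ _ (inj₂ refl) in
      free (H , H∈ , ⊑-trans H (Kₙⁿ n) G H⊑
        (attach (complete n) (f-inj ∘ s-inj) f-adj (s-adh ∘ f)))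
    ...   | inj₂ (f , f-inj , f-adj) =
      let (H , H∈ , H⊑) = ℋ⊑ _ (inj₁ refl) in
      free (H , H∈ , ⊑-trans H (nK₁,ₙ n) G H⊑
        (⊑-trans (nK₁,ₙ n) (attachPendants n (edgeless n)) G (nK₁,ₙ⊑ n)
          (attach (edgeless n) (f-inj ∘ s-inj) f-adj (s-adh ∘ f))))
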